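{- Let $\ell,k$ be positive integers and let $\lambda=[(k2^\ell)^{2^\ell},((k-1)2^\ell)^{2^\ell},\ldots,(2^\ell)^{2^\ell}]$ be the generalized staircase with $r=c=2^\ell$. For integers $i,j\ge0$ with $0\le\lfloor i/2^\ell\rfloor+\lfloor j/2^\ell\rfloor\le k-1$, let $f(i,j)=k-1-\lfloor i/2^\ell\rfloor-\lfloor j/2^\ell\rfloor$, and let $\mathrm{SG}(\mu)$ denote the Sprague-Grundy value of $\mu$ in the game Rook. Then for all such $i,j$, $$\mathrm{SG}(\lambda[i,j])=2^\ell f(i,j)+\Big(\big((-i-1)\oplus(-j-1)\big)\bmod 2^\ell\Big).$$ Furthermore, let $\tau\in\{0,\ldots,k-1\}$ and fix any integer $i$ with $0\le i\le (k-\tau)2^\ell-1$. For $0\le t\le\tau$ let $S_t=\{\mathrm{SG}(\lambda[i,j]) : j\ge 0,\ f(i,j)=t\}$. Then $$S_\tau=\{\tau2^\ell,\tau 2^\ell+1,\ldots,(\tau+1)2^\ell-1\}\quad\text{and}\quad \bigcup_{t=0}^{\tau}S_t=\{0,1,\ldots,(\tau+1)2^\ell-1\}.$$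
   Context: A partition is a finite weakly decreasing sequence $\lambda=[\lambda_1,\ldots,\lambda_s]$ of positive integers (exponents outside a part denote repetition, so $[(k2^\ell)^{2^\ell},\ldots]$ has the part $k2^\ell$ repeated $2^\ell$ times, etc.; $[\,]$ is the empty partition). For $i,j\ge 0$, $\lambda[i,j]=[\lambda_{i+1}-j,\lambda_{i+2}-j,\ldots]$ with trailing nonpositive entries removed. Rook is the impartial game whose positions are nonempty partitions; from $\mu$ a player may move to $\mu[a,b]$ for any $(a,b)\in\{(m,0):m\ge1\}\cup\{(0,m):m\ge1\}$ with $\mu[a,b]\ne[\,]$. The Sprague-Grundy value of a position is the mex (least nonnegative integer not in the set) of the Sprague-Grundy values of the positions reachable in one move. $\oplus$ is bitwise XOR (nim-sum); for negative integers it is taken in two's complement, so that $((-i-1)\oplus(-j-1))\bmod 2^\ell=((-i-1)\bmod 2^\ell)\oplus((-j-1)\bmod 2^\ell)$, with residues in $\{0,\ldots,2^\ell-1\}$. -}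

module Defs where

open import Data.Bool using (Bool; true; false; not; _xor_)
open import Data.Empty using (⊥-elim)
open import Data.Integer using (ℤ; +_; -[1+_]; _%ℕ_)
open import Data.Integer.DivMod using (n%ℕd<d)
open import Data.List using (List; []; _∷_; _++_; map; filter; drop; replicate; concatMap; upTo; length)
open import Data.List.Properties using (map-cong-local; drop-[])
open import Data.List.Membership.Propositional using (_∈_; find; lose)
open import Data.List.Membership.Propositional.Properties using (∈-map⁺; ∈-map⁻; ∈-upTo⁺; ∈-upTo⁻; ∈-filter⁺; ∈-filter⁻; ∈-concatMap⁺; ∈-concatMap⁻)
open import Data.List.Relation.Unary.All as All using (All; []; _∷_)
import Data.List.Relation.Unary.All.Properties as All
open import Data.List.Relation.Unary.Any using (here; there)
open import Data.List.Relation.Unary.AllPairs using (AllPairs; []; _∷_)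
import Data.List.Relation.Unary.AllPairs.Properties as AllPairs
open import Data.List.Relation.Unary.Linked using (Linked)
open import Data.List.Relation.Unary.Linked.Properties using (Linked⇒AllPairs; AllPairs⇒Linked)
open import Data.Nat
open import Data.Nat.DivMod
open import Data.Nat.Divisibility using (divides)
open import Data.Nat.ListAction using (sum)
open import Data.Nat.Properties
open import Data.Nat.Tactic.RingSolver using (solve-∀)
open import Data.List.Membership.DecPropositional _≟_ using (_∈?_)
open import Data.Product using (∃; _×_; _,_)
open import Data.Sum using (inj₁; inj₂)
open import Function using (_∘_; flip)
open import Relation.Binary.PropositionalEquality hiding ([_])
open import Relation.Nullary using (Dec; yes; no; ¬_; contradiction)

record Partition : Set where
  constructor partition
  field
    parts      : List ℕ
    decreasing : Linked _≥_ parts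
    positive   : All (0 <_) parts

open Partition public

NonEmpty : Partition → Set
NonEmpty μ = parts μ ≢ []

nonEmpty? : ∀ μ → Dec (NonEmpty μ)
nonEmpty? (partition []      _ _) = no λ ne → ne refl
nonEmpty? (partition (_ ∷ _) _ _) = yes λ ()

size : Partition → ℕ
size μ = sum (parts μ)

-- Truncated subtraction sends the nonpositive entries to 0; they form a
-- tail because the sequence is weakly decreasing.
shiftParts : List ℕ → ℕ → ℕ → List ℕ
shiftParts xs i j = filter (0 <?_) (map (_∸ j) (drop i xs))

infixl 8 _[_,_]

_[_,_] : Partition → ℕ → ℕ → Partition
parts      (μ [ i , j ]) = shiftParts (parts μ) i j
decreasing (μ [ i , j ]) =
  AllPairs⇒Linked
    (AllPairs.filter⁺ (0 <?_)
      (AllPairs.map⁺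
        (mono (AllPairs.drop⁺ i (Linked⇒AllPairs (flip ≤-trans) (decreasing μ))))))
  where
  mono : ∀ {xs} → AllPairs _≥_ xs → AllPairs (λ x y → x ∸ j ≥ y ∸ j) xs
  mono []       = []
  mono (p ∷ ps) = All.map (∸-monoˡ-≤ j) p ∷ mono ps
positive   (μ [ i , j ]) = All.all-filter (0 <?_) (map (_∸ j) (drop i (parts μ)))

-- [ (k c)^r , ((k-1) c)^r , … , c^r ]
staircaseParts : (r c k : ℕ) → List ℕ
staircaseParts r c zero    = []
staircaseParts r c (suc k) = replicate r (suc k * c) ++ staircaseParts r c k

staircase : (r c k : ℕ) → .{{NonZero c}} → Partition
staircase r c k = partition (staircaseParts r c k)
  (AllPairs⇒Linked (pairs k)) (pos k)
  where
  pos : ∀ k → All (0 <_) (staircaseParts r c k)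
  pos zero    = []
  pos (suc k) = All.++⁺ (All.replicate⁺ r (≤-trans (>-nonZero⁻¹ c) (m≤m+n c (k * c)))) (pos k)

  bound : ∀ {n} k → k ≤ n → All (_≤ n * c) (staircaseParts r c k)
  bound zero    _ = []
  bound (suc k) p = All.++⁺ (All.replicate⁺ r (*-monoˡ-≤ c p)) (bound k (<⇒≤ p))

  rep : ∀ m {x} → AllPairs _≥_ (replicate m x)
  rep zero    = []
  rep (suc m) = All.replicate⁺ m ≤-refl ∷ rep m

  pairs : ∀ k → AllPairs _≥_ (staircaseParts r c k)
  pairs zero    = []
  pairs (suc k) = AllPairs.++⁺ (rep r) (pairs k) (All.replicate⁺ r (bound k (n≤1+n k)))

IsMex : (ℕ → Set) → ℕ → Set
IsMex P n = ¬ P n × (∀ {m} → m < n → P m)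

mexFrom : (fuel n : ℕ) → List ℕ → ℕ
mexFrom zero       n xs = n
mexFrom (suc fuel) n xs with n ∈? xs
... | yes _ = mexFrom fuel (suc n) xs
... | no  _ = n

-- No element of xs exceeds sum xs, so the search always succeeds.
mex : List ℕ → ℕ
mex xs = mexFrom (suc (sum xs)) 0 xs

∈⇒≤sum : ∀ {x xs} → x ∈ xs → x ≤ sum xs
∈⇒≤sum {xs = y ∷ ys} (here refl) = m≤m+n y (sum ys)
∈⇒≤sum {xs = y ∷ ys} (there p)   = ≤-trans (∈⇒≤sum p) (m≤n+m (sum ys) y)

mexFrom-isMex : ∀ fuel n xs → (∀ {m} → m < n → m ∈ xs) → (∀ {x} → x ∈ xs → x < n + fuel) →
                IsMex (_∈ xs) (mexFrom fuel n xs)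
mexFrom-isMex zero n xs below above =
  (λ n∈ → <-irrefl (sym (+-identityʳ n)) (above n∈)) , below
mexFrom-isMex (suc fuel) n xs below above with n ∈? xs
... | no  n∉ = n∉ , below
... | yes n∈ = mexFrom-isMex fuel (suc n) xs below′ (λ {x} x∈ → subst (x <_) (+-suc n fuel) (above x∈))
  where
  below′ : ∀ {m} → m < suc n → m ∈ xs
  below′ (s≤s m≤n) with m≤n⇒m<n∨m≡n m≤n
  ... | inj₁ m<n  = below m<n
  ... | inj₂ refl = n∈

mex-isMex : ∀ xs → IsMex (_∈ xs) (mex xs)
mex-isMex xs = mexFrom-isMex (suc (sum xs)) 0 xs (λ ()) (s≤s ∘ ∈⇒≤sum)

data RookStep : ℕ → ℕ → Set where
  rows    : ∀ {m} → 1 ≤ m → RookStep m 0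
  columns : ∀ {m} → 1 ≤ m → RookStep 0 m

Move : Partition → Partition → Set
Move μ ν = ∃ λ a → ∃ λ b → RookStep a b × ν ≡ μ [ a , b ] × NonEmpty ν

-- A step by more than size μ leaves the empty partition, so these are all
-- the moves from μ (see SG-isMex).
options : Partition → List Partition
options μ = filter nonEmpty?
  (concatMap (λ m → μ [ suc m , 0 ] ∷ μ [ 0 , suc m ] ∷ []) (upTo (size μ)))

-- The fuel bounds the length of play.
SGWithin : ℕ → Partition → ℕ
SGWithin zero       μ = 0
SGWithin (suc fuel) μ = mex (map (SGWithin fuel) (options μ))

-- Each move decreases the size, so size μ is enough fuel.  The empty
-- partition is not a position: it is never moved to, and its value here
-- is irrelevant.
SG : Partition → ℕ
SG μ = SGWithin (size μ) μ

private
  len≤sum : ∀ {xs} → All (0 <_) xs → length xs ≤ sum xs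
  len≤sum []       = z≤n
  len≤sum (p ∷ ps) = +-mono-≤ p (len≤sum ps)

  drop-all : ∀ i (xs : List ℕ) → length xs ≤ i → drop i xs ≡ []
  drop-all i       []       _       = drop-[] i
  drop-all (suc i) (x ∷ xs) (s≤s p) = drop-all i xs p

  shift-all : ∀ j xs → sum xs ≤ j → filter (0 <?_) (map (_∸ j) xs) ≡ []
  shift-all j []       _ = refl
  shift-all j (x ∷ xs) p rewrite m≤n⇒m∸n≡0 (≤-trans (m≤m+n x (sum xs)) p) =
    shift-all j xs (≤-trans (m≤n+m (sum xs) x) p)

  sum-filter : ∀ xs → sum (filter (0 <?_) xs) ≡ sum xs
  sum-filter []           = refl
  sum-filter (zero  ∷ xs) = sum-filter xs
  sum-filter (suc x ∷ xs) = cong (λ s → suc x + s) (sum-filter xs)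

  sum-∸≤ : ∀ j xs → sum (map (_∸ j) xs) ≤ sum xs
  sum-∸≤ j []       = z≤n
  sum-∸≤ j (x ∷ xs) = +-mono-≤ (m∸n≤m x j) (sum-∸≤ j xs)

  sum-drop≤ : ∀ i xs → sum (drop i xs) ≤ sum xs
  sum-drop≤ zero    xs       = ≤-refl
  sum-drop≤ (suc i) []       = z≤n
  sum-drop≤ (suc i) (x ∷ xs) = ≤-trans (sum-drop≤ i xs) (m≤n+m (sum xs) x)

  shrink : ∀ {μ a b} → RookStep a b → NonEmpty (μ [ a , b ]) → size (μ [ a , b ]) < size μ
  shrink {partition [] _ _} {a} {b} _ ne = ⊥-elim (ne (cong (filter (0 <?_) ∘ map (_∸ b)) (drop-[] a)))
  shrink {partition (x ∷ xs) _ (p ∷ _)} (rows {suc m} _) ne = begin-strict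
    sum (filter (0 <?_) (map (_∸ 0) (drop m xs))) ≡⟨ sum-filter (map (_∸ 0) (drop m xs)) ⟩
    sum (map (_∸ 0) (drop m xs))                  ≤⟨ sum-∸≤ 0 (drop m xs) ⟩
    sum (drop m xs)                               ≤⟨ sum-drop≤ m xs ⟩
    sum xs                                        <⟨ +-monoˡ-≤ (sum xs) p ⟩
    x + sum xs                                    ∎
    where open ≤-Reasoning
  shrink {partition (suc x ∷ xs) _ _} (columns {suc m} _) ne = begin-strict
    sum (filter (0 <?_) (map (_∸ suc m) (suc x ∷ xs)))  ≡⟨ sum-filter (map (_∸ suc m) (suc x ∷ xs)) ⟩
    (x ∸ m) + sum (map (_∸ suc m) xs)                   <⟨ +-mono-<-≤ (s≤s (m∸n≤m x m)) (sum-∸≤ (suc m) xs) ⟩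
    suc x + sum xs                                      ∎
    where open ≤-Reasoning

  options-sound : ∀ {μ ν} → ν ∈ options μ → Move μ ν
  options-sound {μ} ν∈ with ∈-filter⁻ nonEmpty? ν∈
  ... | ν∈′ , ne with find (∈-concatMap⁻ _ {xs = upTo (size μ)} ν∈′)
  ... | m , _ , here eq         = suc m , 0 , rows z<s , eq , ne
  ... | m , _ , there (here eq) = 0 , suc m , columns z<s , eq , ne

  options-complete : ∀ {μ ν} → Move μ ν → ν ∈ options μ
  options-complete {μ} (suc m , _ , rows _ , refl , ne) with m <? size μ
  ... | yes m< = ∈-filter⁺ nonEmpty? (∈-concatMap⁺ _ (lose (∈-upTo⁺ m<) (here refl))) ne
  ... | no  m≮ = ⊥-elim (ne (cong (filter (0 <?_) ∘ map (_∸ 0))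
                   (drop-all (suc m) (parts μ)
                     (≤-trans (len≤sum (positive μ)) (m≤n⇒m≤1+n (≮⇒≥ m≮))))))
  options-complete {μ} (_ , suc m , columns _ , refl , ne) with m <? size μ
  ... | yes m< = ∈-filter⁺ nonEmpty? (∈-concatMap⁺ _ (lose (∈-upTo⁺ m<) (there (here refl)))) ne
  ... | no  m≮ = ⊥-elim (ne (shift-all (suc m) (parts μ) (m≤n⇒m≤1+n (≮⇒≥ m≮))))

  options-shrink : ∀ {μ ν} → ν ∈ options μ → size ν < size μ
  options-shrink {μ} ν∈ with options-sound {μ} ν∈
  ... | a , b , st , refl , ne = shrink {μ} st ne

  SGWithin-stable : ∀ f g μ → size μ ≤ f → size μ ≤ g → SGWithin f μ ≡ SGWithin g μ
  SGWithin-stable zero    zero    μ p q = refl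
  SGWithin-stable zero    (suc g) μ p q with size μ
  SGWithin-stable zero    (suc g) μ z≤n q | zero = refl
  SGWithin-stable (suc f) zero    μ p q with size μ
  SGWithin-stable (suc f) zero    μ p z≤n | zero = refl
  SGWithin-stable (suc f) (suc g) μ p q = cong mex (map-cong-local (All.tabulate λ {ν} ν∈ →
    let s = options-shrink {μ} ν∈ in
    SGWithin-stable f g ν (s≤s⁻¹ (≤-trans s p)) (s≤s⁻¹ (≤-trans s q))))

  SG-unfold : ∀ μ → SG μ ≡ mex (map SG (options μ))
  SG-unfold μ = trans (SGWithin-stable (size μ) (suc (size μ)) μ ≤-refl (n≤1+n _))
    (cong mex (map-cong-local (All.tabulate λ {ν} ν∈ →
      SGWithin-stable (size μ) (size ν) ν (<⇒≤ (options-shrink {μ} ν∈)) ≤-refl)))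

-- The defining recursion of Sprague-Grundy values.
SG-isMex : ∀ μ → IsMex (λ g → ∃ λ ν → Move μ ν × SG ν ≡ g) (SG μ)
SG-isMex μ rewrite SG-unfold μ with mex-isMex (map SG (options μ))
... | ∉ , below =
  (λ (ν , mv , eq) → ∉ (subst (_∈ map SG (options μ)) eq (∈-map⁺ SG (options-complete {μ} mv)))) ,
  λ m< → let ν , ν∈ , eq = ∈-map⁻ SG (below m<) in ν , options-sound {μ} ν∈ , sym eq

-- So λ[i,j] is a position of Rook whenever ⌊i/r⌋ + ⌊j/c⌋ ≤ k-1.
staircase-nonEmpty : ∀ r c k i j .{{_ : NonZero r}} .{{_ : NonZero c}} →
                     i / r + j / c < k → NonEmpty (staircase r c k [ i , j ])
staircase-nonEmpty r c k i j p = go k i p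
  where
  surv : ∀ x xs → j < x → filter (0 <?_) (map (_∸ j) (x ∷ xs)) ≢ []
  surv x xs j<x eq with x ∸ j in e
  ... | zero  = <⇒≱ j<x (m∸n≡0⇒m≤n e)
  ... | suc _ = contradiction eq λ ()

  drop-rep< : ∀ m i x ys → i < m → ∃ λ zs → drop i (replicate m x ++ ys) ≡ x ∷ zs
  drop-rep< (suc m) zero    x ys _       = _ , refl
  drop-rep< (suc m) (suc i) x ys (s≤s p) = drop-rep< m i x ys p

  drop-rep≥ : ∀ m i x (ys : List ℕ) → m ≤ i → drop i (replicate m x ++ ys) ≡ drop (i ∸ m) ys
  drop-rep≥ zero    i       x ys _       = refl
  drop-rep≥ (suc m) (suc i) x ys (s≤s p) = drop-rep≥ m i x ys p

  go : ∀ k i → i / r + j / c < k → shiftParts (staircaseParts r c k) i j ≢ []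
  go (suc k) i p with i <? r
  ... | yes i<r with drop-rep< r i (suc k * c) (staircaseParts r c k) i<r
  ...   | zs , eq rewrite eq = surv (suc k * c) zs
            (m/n≡0⇒m<n* (≤-trans (s≤s (m≤n+m (j / c) (i / r))) p))
    where
    m/n≡0⇒m<n* : j / c < suc k → j < suc k * c
    m/n≡0⇒m<n* q with j <? suc k * c
    ... | yes r = r
    ... | no ¬r = contradiction q (≤⇒≯ (subst (_≤ j / c) (m*n/n≡m (suc k) c) (/-monoˡ-≤ c (≮⇒≥ ¬r))))
  go (suc k) i p | no i≮r rewrite drop-rep≥ r i (suc k * c) (staircaseParts r c k) (≮⇒≥ i≮r) =
    go k (i ∸ r) (s≤s⁻¹ (subst (λ v → v + j / c < suc k) (m/n≡1+[m∸n]/n (≮⇒≥ i≮r)) p))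

-- Bit by bit, least significant first; m + n halvings exhaust all bits.
xorWithin : (fuel : ℕ) → ℕ → ℕ → ℕ
xorWithin zero       m n = 0
xorWithin (suc fuel) m n = (m % 2 + n % 2) % 2 + 2 * xorWithin fuel (m / 2) (n / 2)

infixl 6 _⊕ⁿ_ _⊕_

_⊕ⁿ_ : ℕ → ℕ → ℕ
m ⊕ⁿ n = xorWithin (m + n) m n

-- In two's complement -[1+ n ] = -n-1 is the bitwise complement of n, and
-- complementing one argument of a XOR complements the result.
_⊕_ : ℤ → ℤ → ℤ
+ m      ⊕ + n      = + (m ⊕ⁿ n)
+ m      ⊕ -[1+ n ] = -[1+ m ⊕ⁿ n ]
-[1+ m ] ⊕ + n      = -[1+ m ⊕ⁿ n ]
-[1+ m ] ⊕ -[1+ n ] = + (m ⊕ⁿ n)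

infixl 7 _/2^_ _%2^_

_/2^_ : ℕ → ℕ → ℕ
m /2^ ℓ = _/_ m (2 ^ ℓ) {{m^n≢0 2 ℓ}}

_%2^_ : ℤ → ℕ → ℕ
z %2^ ℓ = _%ℕ_ z (2 ^ ℓ) {{m^n≢0 2 ℓ}}

private
  bit : Bool → ℕ
  bit false = 0
  bit true  = 1

  bit<2 : ∀ b → bit b < 2
  bit<2 false = s≤s z≤n
  bit<2 true  = s≤s (s≤s z≤n)

  bit-% : ∀ b m → (bit b + 2 * m) % 2 ≡ bit b
  bit-% b m = trans (cong (λ v → (bit b + v) % 2) (*-comm 2 m))
    (trans ([m+kn]%n≡m%n (bit b) m 2) (m<n⇒m%n≡m (bit<2 b)))

  bit-/ : ∀ b m → (bit b + 2 * m) / 2 ≡ m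
  bit-/ b m = trans (cong (λ v → (bit b + v) / 2) (*-comm 2 m))
    (trans (+-distrib-/-∣ʳ (bit b) (divides m refl))
      (cong₂ _+_ (m<n⇒m/n≡0 (bit<2 b)) (m*n/n≡m m 2)))

  bit-xor : ∀ b c → (bit b + bit c) % 2 ≡ bit (b xor c)
  bit-xor false false = refl
  bit-xor false true  = refl
  bit-xor true  false = refl
  bit-xor true  true  = refl

  half≤ : ∀ {m f} → m ≤ suc f → m / 2 ≤ f
  half≤ {zero}  p = z≤n
  half≤ {suc m} p = s≤s⁻¹ (≤-trans (m/n<m (suc m) 2 (s≤s (s≤s z≤n))) p)

  xorWithin-00 : ∀ f → xorWithin f 0 0 ≡ 0
  xorWithin-00 zero    = refl
  xorWithin-00 (suc f) = cong (2 *_) (xorWithin-00 f)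

  xorWithin-stable : ∀ f g m n → m ≤ f → n ≤ f → m ≤ g → n ≤ g → xorWithin f m n ≡ xorWithin g m n
  xorWithin-stable zero g zero zero _ _ _ _ = sym (xorWithin-00 g)
  xorWithin-stable (suc f) zero zero zero _ _ _ _ = xorWithin-00 (suc f)
  xorWithin-stable (suc f) (suc g) m n p q r s =
    cong (λ v → (m % 2 + n % 2) % 2 + 2 * v)
      (xorWithin-stable f g (m / 2) (n / 2) (half≤ p) (half≤ q) (half≤ r) (half≤ s))

  ⊕ⁿ-bit : ∀ b c m n → (bit b + 2 * m) ⊕ⁿ (bit c + 2 * n) ≡ bit (b xor c) + 2 * (m ⊕ⁿ n)
  ⊕ⁿ-bit b c m n = begin
    xorWithin (M + N) M N                                        ≡⟨ xorWithin-stable (M + N) (suc (M + N)) M N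
                                                                      (m≤m+n M N) (m≤n+m N M) (m≤n⇒m≤1+n (m≤m+n M N)) (m≤n⇒m≤1+n (m≤n+m N M)) ⟩
    (M % 2 + N % 2) % 2 + 2 * xorWithin (M + N) (M / 2) (N / 2)  ≡⟨ cong₂ (λ u v → (u + v) % 2 + 2 * xorWithin (M + N) (M / 2) (N / 2)) (bit-% b m) (bit-% c n) ⟩
    (bit b + bit c) % 2 + 2 * xorWithin (M + N) (M / 2) (N / 2)  ≡⟨ cong₂ (λ u v → u + 2 * v) (bit-xor b c)
                                                                      (cong₂ (xorWithin (M + N)) (bit-/ b m) (bit-/ c n)) ⟩
    bit (b xor c) + 2 * xorWithin (M + N) m n                    ≡⟨ cong (λ v → bit (b xor c) + 2 * v)
                                                                      (xorWithin-stable (M + N) (m + n) m n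
                                                                        (≤-trans (le b m) (m≤m+n M N)) (≤-trans (le c n) (m≤n+m N M)) (m≤m+n m n) (m≤n+m n m)) ⟩
    bit (b xor c) + 2 * (m ⊕ⁿ n)                                 ∎
    where
    open ≡-Reasoning
    M = bit b + 2 * m
    N = bit c + 2 * n
    le : ∀ b m → m ≤ bit b + 2 * m
    le b m = ≤-trans (m≤m+n m (m + 0)) (m≤n+m (2 * m) (bit b))

  -- bit b + 2 z
  cons : Bool → ℤ → ℤ
  cons b (+ m)    = + (bit b + 2 * m)
  cons b -[1+ m ] = -[1+ bit (not b) + 2 * m ]

  data View : ℤ → Set where
    view : ∀ b z → View (cons b z)

  viewℕ : ∀ m → ∃ λ b → ∃ λ n → m ≡ bit b + 2 * n
  viewℕ zero = false , 0 , refl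
  viewℕ (suc m) with viewℕ m
  ... | false , n , refl = true  , n , refl
  ... | true  , n , refl = false , suc n , cong suc (sym (+-suc n (n + 0)))

  viewℤ : ∀ z → View z
  viewℤ (+ m) with viewℕ m
  ... | b , n , refl = view b (+ n)
  viewℤ -[1+ m ] with viewℕ m
  ... | false , n , refl = view true -[1+ n ]
  ... | true  , n , refl = view false -[1+ n ]

  ⊕-cons : ∀ b c x y → cons b x ⊕ cons c y ≡ cons (b xor c) (x ⊕ y)
  ⊕-cons b c (+ m) (+ n) = cong +_ (⊕ⁿ-bit b c m n)
  ⊕-cons b c (+ m) -[1+ n ] = cong -[1+_] (trans (⊕ⁿ-bit b (not c) m n) (cong (λ d → bit d + 2 * (m ⊕ⁿ n)) (lem b c)))
    where
    lem : ∀ b c → b xor not c ≡ not (b xor c)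
    lem false c     = refl
    lem true  c     = refl
  ⊕-cons b c -[1+ m ] (+ n) = cong -[1+_] (trans (⊕ⁿ-bit (not b) c m n) (cong (λ d → bit d + 2 * (m ⊕ⁿ n)) (lem b c)))
    where
    lem : ∀ b c → not b xor c ≡ not (b xor c)
    lem false c     = refl
    lem true  false = refl
    lem true  true  = refl
  ⊕-cons b c -[1+ m ] -[1+ n ] = cong +_ (trans (⊕ⁿ-bit (not b) (not c) m n) (cong (λ d → bit d + 2 * (m ⊕ⁿ n)) (lem b c)))
    where
    lem : ∀ b c → not b xor not c ≡ b xor c
    lem false false = refl
    lem false true  = refl
    lem true  false = refl
    lem true  true  = refl

  suc-% : ∀ m d .{{_ : NonZero d}} → suc m % d ≡ suc (m % d) % d
  suc-% m d = trans (cong (λ v → suc v % d) (m≡m%n+[m/n]*n m d)) ([m+kn]%n≡m%n (suc (m % d)) (m / d) d)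

  %ℕ-neg : ∀ m d .{{_ : NonZero d}} → -[1+ m ] %ℕ d ≡ d ∸ suc (m % d)
  %ℕ-neg m d with suc m % d in eq
  ... | zero  rewrite %-pred-≡0 {m} {d} eq = sym (m≤n⇒m∸n≡0 (m≤n+m∸n d 1))
  ... | suc r with m≤n⇒m<n∨m≡n (m%n<n m d)
  ...   | inj₁ lt = cong (d ∸_) (trans (sym eq) (trans (suc-% m d) (m<n⇒m%n≡m lt)))
  ...   | inj₂ e  = contradiction
            (trans (sym eq) (trans (suc-% m d) (trans (cong (_% d) e) (n%n≡0 d)))) λ ()

  double< : ∀ b {r D} → r < D → bit b + 2 * r < 2 * D
  double< b {r} {D} r<D = begin-strict
    bit b + 2 * r <⟨ +-monoˡ-< (2 * r) (bit<2 b) ⟩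
    2 + 2 * r     ≡⟨ *-suc 2 r ⟨
    2 * suc r     ≤⟨ *-monoʳ-≤ 2 r<D ⟩
    2 * D         ∎
    where open ≤-Reasoning

  double-% : ∀ b m D .{{_ : NonZero D}} .{{_ : NonZero (2 * D)}} →
             (bit b + 2 * m) % (2 * D) ≡ bit b + 2 * (m % D)
  double-% b m D = begin
    (bit b + 2 * m) % (2 * D)                              ≡⟨ cong (λ v → (bit b + 2 * v) % (2 * D)) (m≡m%n+[m/n]*n m D) ⟩
    (bit b + 2 * (m % D + m / D * D)) % (2 * D)            ≡⟨ cong (_% (2 * D)) (rearrange (bit b) (m % D) (m / D) D) ⟩
    ((bit b + 2 * (m % D)) + m / D * (2 * D)) % (2 * D)    ≡⟨ [m+kn]%n≡m%n (bit b + 2 * (m % D)) (m / D) (2 * D) ⟩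
    (bit b + 2 * (m % D)) % (2 * D)                        ≡⟨ m<n⇒m%n≡m (double< b (m%n<n m D)) ⟩
    bit b + 2 * (m % D)                                    ∎
    where
    open ≡-Reasoning
    rearrange : ∀ b r q D → b + 2 * (r + q * D) ≡ (b + 2 * r) + q * (2 * D)
    rearrange = solve-∀

  double-∸ : ∀ b {r D} → r < D → 2 * D ∸ suc (bit (not b) + 2 * r) ≡ bit b + 2 * (D ∸ suc r)
  double-∸ b {r} {D} r<D = begin
    2 * D ∸ suc (bit (not b) + 2 * r)
      ≡⟨ cong (λ v → 2 * v ∸ suc (bit (not b) + 2 * r)) (sym (m+[n∸m]≡n r<D)) ⟩
    2 * (suc r + e) ∸ suc (bit (not b) + 2 * r)
      ≡⟨ cong (_∸ suc (bit (not b) + 2 * r)) (eq b) ⟩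
    (bit b + 2 * e) + suc (bit (not b) + 2 * r) ∸ suc (bit (not b) + 2 * r)
      ≡⟨ m+n∸n≡m (bit b + 2 * e) (suc (bit (not b) + 2 * r)) ⟩
    bit b + 2 * e ∎
    where
    open ≡-Reasoning
    e = D ∸ suc r
    eq₀ : ∀ r e → 2 * (suc r + e) ≡ (0 + 2 * e) + suc (1 + 2 * r)
    eq₀ = solve-∀
    eq₁ : ∀ r e → 2 * (suc r + e) ≡ (1 + 2 * e) + suc (0 + 2 * r)
    eq₁ = solve-∀
    eq : ∀ b → 2 * (suc r + e) ≡ (bit b + 2 * e) + suc (bit (not b) + 2 * r)
    eq false = eq₀ r e
    eq true  = eq₁ r e

  cons-% : ∀ ℓ b z → cons b z %2^ suc ℓ ≡ bit b + 2 * (z %2^ ℓ)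
  cons-% ℓ b (+ m) = double-% b m (2 ^ ℓ) {{m^n≢0 2 ℓ}} {{m^n≢0 2 (suc ℓ)}}
  cons-% ℓ b -[1+ m ] = begin
    -[1+ bit (not b) + 2 * m ] %ℕ (2 * 2 ^ ℓ)               ≡⟨ %ℕ-neg (bit (not b) + 2 * m) (2 * 2 ^ ℓ) ⟩
    2 * 2 ^ ℓ ∸ suc ((bit (not b) + 2 * m) % (2 * 2 ^ ℓ))   ≡⟨ cong (λ v → 2 * 2 ^ ℓ ∸ suc v) (double-% (not b) m (2 ^ ℓ)) ⟩
    2 * 2 ^ ℓ ∸ suc (bit (not b) + 2 * (m % 2 ^ ℓ))         ≡⟨ double-∸ b (m%n<n m (2 ^ ℓ)) ⟩
    bit b + 2 * (2 ^ ℓ ∸ suc (m % 2 ^ ℓ))                   ≡⟨ cong (λ v → bit b + 2 * v) (%ℕ-neg m (2 ^ ℓ)) ⟨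
    bit b + 2 * (-[1+ m ] %2^ ℓ)                         ∎
    where
    open ≡-Reasoning
    instance
      _ : NonZero (2 ^ ℓ)
      _ = m^n≢0 2 ℓ
      _ : NonZero (2 * 2 ^ ℓ)
      _ = m^n≢0 2 (suc ℓ)

⊕-mod : ∀ ℓ x y → (x ⊕ y) %2^ ℓ ≡ (x %2^ ℓ) ⊕ⁿ (y %2^ ℓ)
⊕-mod zero    x y = trans (%1 (x ⊕ y)) (sym (cong₂ _⊕ⁿ_ (%1 x) (%1 y)))
  where
  %1 : ∀ z → z %ℕ 1 ≡ 0
  %1 z = n<1⇒n≡0 (n%ℕd<d z 1)
⊕-mod (suc ℓ) x y = go (viewℤ x) (viewℤ y)
  where
  open ≡-Reasoning
  go : ∀ {x y} → View x → View y → (x ⊕ y) %2^ suc ℓ ≡ (x %2^ suc ℓ) ⊕ⁿ (y %2^ suc ℓ)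
  go (view b x) (view c y) = begin
    (cons b x ⊕ cons c y) %2^ suc ℓ                         ≡⟨ cong (_%2^ suc ℓ) (⊕-cons b c x y) ⟩
    cons (b xor c) (x ⊕ y) %2^ suc ℓ                        ≡⟨ cons-% ℓ (b xor c) (x ⊕ y) ⟩
    bit (b xor c) + 2 * ((x ⊕ y) %2^ ℓ)                     ≡⟨ cong (λ v → bit (b xor c) + 2 * v) (⊕-mod ℓ x y) ⟩
    bit (b xor c) + 2 * ((x %2^ ℓ) ⊕ⁿ (y %2^ ℓ))         ≡⟨ ⊕ⁿ-bit b c (x %2^ ℓ) (y %2^ ℓ) ⟨
    (bit b + 2 * (x %2^ ℓ)) ⊕ⁿ (bit c + 2 * (y %2^ ℓ))   ≡⟨ cong₂ _⊕ⁿ_ (cons-% ℓ b x) (cons-% ℓ c y) ⟨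
    (cons b x %2^ suc ℓ) ⊕ⁿ (cons c y %2^ suc ℓ)         ∎

{-# OPTIONS --safe #-}

-- Put D = 2^ℓ, and let v(i,j) be the claimed value.  By division with
-- remainder by D, v(i,j) = D f(i,j) + (i mod D ⊕ j mod D).  Along a row or a
-- column v is injective, because XOR cancels.  Given n = D t + s < v(i,j), a
-- move along the row reaches the value n: if t < f(i,j) then the column with
-- quotient j/D + f(i,j) - t and remainder s ⊕ (i mod D) lies further on, and
-- if t = f(i,j) then this column, or the analogous row, lies further on by the
-- argument for two-heap Nim, in which the inequalities reverse since passing
-- to the complements D - 1 - x does not change x ⊕ y.
module Submission where

open import Data.Empty using (⊥)
open import Data.Integer as ℤ using (+_; -[1+_])
open import Data.List using (List; []; _∷_; _++_; map; filter; drop; replicate)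
open import Data.List.Properties using (drop-drop; drop-map; drop-[]; filter-none; map-∘; map-cong)
import Data.List.Relation.Unary.All as All
open import Data.List.Relation.Unary.All using (All; []; _∷_)
import Data.List.Relation.Unary.All.Properties as All
open import Data.List.Relation.Unary.AllPairs using (AllPairs; []; _∷_)
import Data.List.Relation.Unary.AllPairs.Properties as AllPairs
import Data.List.Relation.Unary.Linked as Linked
open import Data.List.Relation.Unary.Linked.Properties using (Linked⇒AllPairs)
open import Data.Nat
open import Data.Nat.Divisibility using (divides-refl)
open import Data.Nat.DivMod
open import Data.Nat.Properties
open import Data.Nat.Tactic.RingSolver using (solve-∀)
open import Data.Product using (∃; _×_; _,_; proj₁; proj₂)
open import Data.Sum using (_⊎_; inj₁; inj₂)
open import Function using (flip; _∘_)
open import Relation.Binary.Definitions using (tri<; tri≈; tri>)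
open import Relation.Binary.PropositionalEquality hiding ([_])
open import Relation.Nullary using (yes; no; contradiction)
open import Relation.Unary using (_∈_; _≐_)
open import Defs

-- Division with remainder

module _ (d : ℕ) .{{_ : NonZero d}} where

  [r+qd]/d≡q : ∀ {r} q → r < d → (r + q * d) / d ≡ q
  [r+qd]/d≡q {r} q r<d = trans (+-distrib-/-∣ʳ r (divides-refl q))
    (cong₂ _+_ (m<n⇒m/n≡0 r<d) (m*n/n≡m q d))

  [r+qd]%d≡r : ∀ {r} q → r < d → (r + q * d) % d ≡ r
  [r+qd]%d≡r {r} q r<d = trans ([m+kn]%n≡m%n r q d) (m<n⇒m%n≡m r<d)

  /-%-injective : ∀ {m n} → m / d ≡ n / d → m % d ≡ n % d → m ≡ n
  /-%-injective {m} {n} q r = trans (m≡m%n+[m/n]*n m d)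
    (trans (cong₂ (λ a b → a + b * d) r q) (sym (m≡m%n+[m/n]*n n d)))

  /-reflects-< : ∀ {m n} → m / d < n / d → m < n
  /-reflects-< lt = ≰⇒> λ n≤m → <⇒≱ lt (/-monoˡ-≤ d n≤m)

  /-%-reflects-< : ∀ {m n} → m / d ≡ n / d → m % d < n % d → m < n
  /-%-reflects-< {m} {n} q lt = subst₂ _<_ (sym (m≡m%n+[m/n]*n m d))
    (trans (cong (λ v → n % d + v * d) q) (sym (m≡m%n+[m/n]*n n d)))
    (+-monoˡ-< (m / d * d) lt)

  <⇒/<⊎%< : ∀ {m n} → m < n → m / d < n / d ⊎ (m / d ≡ n / d × m % d < n % d)
  <⇒/<⊎%< {m} {n} m<n with m≤n⇒m<n∨m≡n (/-monoˡ-≤ d (<⇒≤ m<n))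
  ... | inj₁ lt = inj₁ lt
  ... | inj₂ eq = inj₂ (eq , ≰⇒> λ n%≤m% → <⇒≱ m<n (subst₂ _≤_
    (sym (m≡m%n+[m/n]*n n d))
    (trans (cong (λ v → m % d + v * d) (sym eq)) (sym (m≡m%n+[m/n]*n m d)))
    (+-monoˡ-≤ (n / d * d) n%≤m%)))

  /<⇒<* : ∀ {m k} → m / d < k → m < k * d
  /<⇒<* {m} {k} lt = ≰⇒> λ kd≤m → <⇒≱ lt (subst (_≤ m / d) (m*n/n≡m k d) (/-monoˡ-≤ d kd≤m))

-- Bitwise XOR

half-≤ : ∀ {m f} → m ≤ suc f → m / 2 ≤ f
half-≤ {zero}  _ = z≤n
half-≤ {suc m} p = s≤s⁻¹ (≤-trans (m/n<m (suc m) 2 (s≤s (s≤s z≤n))) p)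

xorWithin-zero : ∀ f → xorWithin f 0 0 ≡ 0
xorWithin-zero zero    = refl
xorWithin-zero (suc f) = cong (2 *_) (xorWithin-zero f)

-- Halving lowers a bound `suc f` to `f`, so fuel bounding both arguments never runs out. The fuel
-- `m + n` built into `⊕ⁿ` can thus be exchanged during recursion.
xorWithin-fuel : ∀ f g {m n} → m ≤ f → n ≤ f → m ≤ g → n ≤ g → xorWithin f m n ≡ xorWithin g m n
xorWithin-fuel zero    g       z≤n z≤n _   _   = sym (xorWithin-zero g)
xorWithin-fuel (suc f) zero    _   _   z≤n z≤n = xorWithin-zero (suc f)
xorWithin-fuel (suc f) (suc g) {m} {n} p q r s =
  cong (λ v → (m % 2 + n % 2) % 2 + 2 * v)
    (xorWithin-fuel f g (half-≤ p) (half-≤ q) (half-≤ r) (half-≤ s))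

-- The form remainder plus quotient times 2 lets the division lemmas read off the lowest bit and the
-- half.
⊕ⁿ-unfold : ∀ m n → m ⊕ⁿ n ≡ (m % 2 + n % 2) % 2 + (m / 2 ⊕ⁿ n / 2) * 2
⊕ⁿ-unfold m n = begin
  xorWithin (m + n) m n
    ≡⟨ xorWithin-fuel (m + n) (suc (m + n)) m≤ n≤ (m≤n⇒m≤1+n m≤) (m≤n⇒m≤1+n n≤) ⟩
  (m % 2 + n % 2) % 2 + 2 * xorWithin (m + n) (m / 2) (n / 2)
    ≡⟨ cong (λ v → (m % 2 + n % 2) % 2 + v) (*-comm 2 (xorWithin (m + n) (m / 2) (n / 2))) ⟩
  (m % 2 + n % 2) % 2 + xorWithin (m + n) (m / 2) (n / 2) * 2
    ≡⟨ cong (λ v → (m % 2 + n % 2) % 2 + v * 2)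
         (xorWithin-fuel (m + n) (m / 2 + n / 2)
           (≤-trans (m/n≤m m 2) m≤) (≤-trans (m/n≤m n 2) n≤) (m≤m+n _ _) (m≤n+m _ _)) ⟩
  (m % 2 + n % 2) % 2 + (m / 2 ⊕ⁿ n / 2) * 2 ∎
  where
  open ≡-Reasoning
  m≤ : m ≤ m + n
  m≤ = m≤m+n m n
  n≤ : n ≤ m + n
  n≤ = m≤n+m n m

⊕ⁿ-/2 : ∀ m n → (m ⊕ⁿ n) / 2 ≡ m / 2 ⊕ⁿ n / 2
⊕ⁿ-/2 m n = trans (cong (_/ 2) (⊕ⁿ-unfold m n)) ([r+qd]/d≡q 2 _ (m%n<n (m % 2 + n % 2) 2))

⊕ⁿ-%2 : ∀ m n → (m ⊕ⁿ n) % 2 ≡ (m % 2 + n % 2) % 2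
⊕ⁿ-%2 m n = trans (cong (_% 2) (⊕ⁿ-unfold m n)) ([r+qd]%d≡r 2 (m / 2 ⊕ⁿ n / 2) (m%n<n (m % 2 + n % 2) 2))

⊕ⁿ-comm : ∀ m n → m ⊕ⁿ n ≡ n ⊕ⁿ m
⊕ⁿ-comm m n = trans (within (m + n) m n) (cong (λ f → xorWithin f n m) (+-comm m n))
  where
  within : ∀ f m n → xorWithin f m n ≡ xorWithin f n m
  within zero    m n = refl
  within (suc f) m n = cong₂ (λ u v → u % 2 + 2 * v) (+-comm (m % 2) (n % 2)) (within f (m / 2) (n / 2))

-- Both sides have the same half by recursion on a common bound of the arguments, and the same
-- lowest bit by the four cases of `bits`.
⊕ⁿ-cancel : ∀ m n → (m ⊕ⁿ n) ⊕ⁿ n ≡ m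
⊕ⁿ-cancel m n = within (m + n) (m≤m+n m n) (m≤n+m n m)
  where
  bits : ∀ {a b} → a < 2 → b < 2 → ((a + b) % 2 + b) % 2 ≡ a
  bits (s≤s z≤n)       (s≤s z≤n)       = refl
  bits (s≤s z≤n)       (s≤s (s≤s z≤n)) = refl
  bits (s≤s (s≤s z≤n)) (s≤s z≤n)       = refl
  bits (s≤s (s≤s z≤n)) (s≤s (s≤s z≤n)) = refl
  within : ∀ f {m n} → m ≤ f → n ≤ f → (m ⊕ⁿ n) ⊕ⁿ n ≡ m
  within zero            z≤n z≤n = refl
  within (suc f) {m} {n} p   q   = /-%-injective 2
    (trans (⊕ⁿ-/2 (m ⊕ⁿ n) n)
      (trans (cong (λ v → v ⊕ⁿ n / 2) (⊕ⁿ-/2 m n)) (within f (half-≤ p) (half-≤ q))))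
    (trans (⊕ⁿ-%2 (m ⊕ⁿ n) n)
      (trans (cong (λ v → (v + n % 2) % 2) (⊕ⁿ-%2 m n)) (bits (m%n<n m 2) (m%n<n n 2))))

⊕ⁿ-cancelˡ : ∀ m n → m ⊕ⁿ (n ⊕ⁿ m) ≡ n
⊕ⁿ-cancelˡ m n = trans (⊕ⁿ-comm m (n ⊕ⁿ m)) (⊕ⁿ-cancel n m)

⊕ⁿ-injectiveʳ : ∀ m {n o} → m ⊕ⁿ n ≡ m ⊕ⁿ o → n ≡ o
⊕ⁿ-injectiveʳ m {n} {o} eq = begin
  n               ≡⟨ ⊕ⁿ-cancel n m ⟨
  (n ⊕ⁿ m) ⊕ⁿ m   ≡⟨ cong (_⊕ⁿ m) (⊕ⁿ-comm n m) ⟩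
  (m ⊕ⁿ n) ⊕ⁿ m   ≡⟨ cong (_⊕ⁿ m) eq ⟩
  (m ⊕ⁿ o) ⊕ⁿ m   ≡⟨ cong (_⊕ⁿ m) (⊕ⁿ-comm m o) ⟩
  (o ⊕ⁿ m) ⊕ⁿ m   ≡⟨ ⊕ⁿ-cancel o m ⟩
  o               ∎
  where open ≡-Reasoning

-- At the highest bit where r and x ⊕ y differ, r has 0 and exactly one of x
-- and y has 0; XOR with r then raises that one to the other.
⊕ⁿ-increase : ∀ r x y → r < x ⊕ⁿ y → x < r ⊕ⁿ y ⊎ y < r ⊕ⁿ x
⊕ⁿ-increase r x y = within (r + (x + y)) (m≤m+n r (x + y))
  (≤-trans (m≤m+n x y) (m≤n+m (x + y) r)) (≤-trans (m≤n+m y x) (m≤n+m (x + y) r))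
  where
  bits : ∀ {r a b} → a < 2 → b < 2 → r < (a + b) % 2 → a < (r + b) % 2 ⊎ b < (r + a) % 2
  bits (s≤s z≤n)       (s≤s z≤n)       ()
  bits (s≤s z≤n)       (s≤s (s≤s z≤n)) (s≤s z≤n) = inj₁ (s≤s z≤n)
  bits (s≤s (s≤s z≤n)) (s≤s z≤n)       (s≤s z≤n) = inj₂ (s≤s z≤n)
  bits (s≤s (s≤s z≤n)) (s≤s (s≤s z≤n)) ()
  halves : ∀ r x y → x / 2 < r / 2 ⊕ⁿ y / 2 → x < r ⊕ⁿ y
  halves r x y lt = /-reflects-< 2 (subst (x / 2 <_) (sym (⊕ⁿ-/2 r y)) lt)
  remainders : ∀ r x y → r / 2 ≡ x / 2 ⊕ⁿ y / 2 → x % 2 < (r % 2 + y % 2) % 2 → x < r ⊕ⁿ y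
  remainders r x y eq lt = /-%-reflects-< 2
    (sym (trans (⊕ⁿ-/2 r y) (trans (cong (λ v → v ⊕ⁿ y / 2) eq) (⊕ⁿ-cancel (x / 2) (y / 2)))))
    (subst (x % 2 <_) (sym (⊕ⁿ-%2 r y)) lt)
  within : ∀ f {r x y} → r ≤ f → x ≤ f → y ≤ f → r < x ⊕ⁿ y → x < r ⊕ⁿ y ⊎ y < r ⊕ⁿ x
  within zero z≤n z≤n z≤n ()
  within (suc f) {r} {x} {y} p q s lt with <⇒/<⊎%< 2 lt
  ... | inj₁ lt/ with within f (half-≤ p) (half-≤ q) (half-≤ s) (subst (r / 2 <_) (⊕ⁿ-/2 x y) lt/)
  ...   | inj₁ l = inj₁ (halves r x y l)
  ...   | inj₂ l = inj₂ (halves r y x l)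
  -- The halves of `r` and `x ⊕ⁿ y` agree here, so the lowest bit is the only one at which they
  -- differ.
  within (suc f) {r} {x} {y} p q s lt | inj₂ (eq , lt%)
    with bits (m%n<n x 2) (m%n<n y 2) (subst (r % 2 <_) (⊕ⁿ-%2 x y) lt%)
  ...   | inj₁ l = inj₁ (remainders r x y (trans eq (⊕ⁿ-/2 x y)) l)
  ...   | inj₂ l = inj₂ (remainders r y x
            (trans eq (trans (⊕ⁿ-/2 x y) (⊕ⁿ-comm (x / 2) (y / 2)))) l)

-- Positions inside a staircase

-- Proofs of `≤` on natural numbers are unique, hence so are the two proof fields.
partition-≡ : ∀ {μ ν} → parts μ ≡ parts ν → μ ≡ ν
partition-≡ {partition xs d p} {partition .xs d′ p′} refl =
  cong₂ (partition xs) (Linked.irrelevant ≤-irrelevant d d′) (All.irrelevant ≤-irrelevant p p′)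

-- In a weakly decreasing list the zeros form a tail, so filtering only cuts off a tail.
drop-filter-positive : ∀ n {xs} → AllPairs _≥_ xs →
                       drop n (filter (0 <?_) xs) ≡ filter (0 <?_) (drop n xs)
drop-filter-positive zero                _        = refl
drop-filter-positive (suc n)             []       = refl
drop-filter-positive (suc n) {suc x ∷ _} (_ ∷ ps) = drop-filter-positive n ps
drop-filter-positive (suc n) {zero  ∷ xs} (p ∷ _) =
  trans (cong (drop (suc n)) (none p)) (sym (none (All.drop⁺ n p)))
  where
  none : ∀ {ys} → All (0 ≥_) ys → filter (0 <?_) ys ≡ []
  none = filter-none (0 <?_) ∘ All.map ≤⇒≯

-- A zero stays zero under truncated subtraction, so removing it early or late is the same.
filter-∸-filter : ∀ b xs → filter (0 <?_) (map (_∸ b) (filter (0 <?_) xs)) ≡ filter (0 <?_) (map (_∸ b) xs)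
filter-∸-filter b []           = refl
filter-∸-filter b (suc x ∷ xs) with suc x ∸ b
... | zero  = filter-∸-filter b xs
... | suc y = cong (suc y ∷_) (filter-∸-filter b xs)
filter-∸-filter b (zero ∷ xs) rewrite 0∸n≡0 b = filter-∸-filter b xs

-- Every position reached from the staircase is thereby again given by a pair of coordinates.
shift-shift : ∀ μ i j a b → μ [ i , j ] [ a , b ] ≡ μ [ i + a , j + b ]
shift-shift μ i j a b = partition-≡ (begin
  filter (0 <?_) (map (_∸ b) (drop a (filter (0 <?_) (map (_∸ j) xs))))
    ≡⟨ cong (filter (0 <?_) ∘ map (_∸ b)) (drop-filter-positive a sorted) ⟩
  filter (0 <?_) (map (_∸ b) (filter (0 <?_) (drop a (map (_∸ j) xs))))
    ≡⟨ filter-∸-filter b (drop a (map (_∸ j) xs)) ⟩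
  filter (0 <?_) (map (_∸ b) (drop a (map (_∸ j) xs)))
    ≡⟨ cong (filter (0 <?_) ∘ map (_∸ b)) (drop-map a xs) ⟩
  filter (0 <?_) (map (_∸ b) (map (_∸ j) (drop a xs)))
    ≡⟨ cong (filter (0 <?_)) (map-∘ (drop a xs)) ⟨
  filter (0 <?_) (map (λ x → x ∸ j ∸ b) (drop a xs))
    ≡⟨ cong (filter (0 <?_)) (map-cong (λ x → ∸-+-assoc x j b) (drop a xs)) ⟩
  filter (0 <?_) (map (_∸ (j + b)) (drop a xs))
    ≡⟨ cong (filter (0 <?_) ∘ map (_∸ (j + b))) (drop-drop i a (parts μ)) ⟩
  filter (0 <?_) (map (_∸ (j + b)) (drop (i + a) (parts μ))) ∎)
  where
  open ≡-Reasoning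
  xs : List ℕ
  xs = drop i (parts μ)
  mono : ∀ {ys} → AllPairs _≥_ ys → AllPairs (λ x y → x ∸ j ≥ y ∸ j) ys
  mono []       = []
  mono (p ∷ ps) = All.map (∸-monoˡ-≤ j) p ∷ mono ps
  sorted : AllPairs _≥_ (map (_∸ j) xs)
  sorted = AllPairs.map⁺ (mono (AllPairs.drop⁺ i (Linked⇒AllPairs (flip ≤-trans) (decreasing μ))))

staircaseParts-≤ : ∀ r c k → All (_≤ k * c) (staircaseParts r c k)
staircaseParts-≤ r c zero    = []
staircaseParts-≤ r c (suc k) = All.++⁺ (All.replicate⁺ r ≤-refl)
  (All.map (λ p → ≤-trans p (m≤n+m (k * c) c)) (staircaseParts-≤ r c k))

drop-replicate-++ : ∀ r x (ys : List ℕ) → drop r (replicate r x ++ ys) ≡ ys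
drop-replicate-++ zero    x ys = refl
drop-replicate-++ (suc r) x ys = drop-replicate-++ r x ys

module _ (r c : ℕ) .{{_ : NonZero r}} .{{_ : NonZero c}} where

  -- Each full block of `r` dropped rows lowers the largest remaining part by `c`. After `i / r`
  -- blocks either nothing is left or all parts are at most `j / c * c`.
  drop-staircaseParts-≤ : ∀ k i j → k ≤ i / r + j / c → All (_≤ j) (drop i (staircaseParts r c k))
  drop-staircaseParts-≤ zero    i j _ rewrite drop-[] {A = ℕ} i = []
  drop-staircaseParts-≤ (suc k) i j k≤ with i <? r
  ... | yes i<r = All.drop⁺ i (All.map (λ p → ≤-trans p kc≤j) (staircaseParts-≤ r c (suc k)))
    where
    kc≤j : suc k * c ≤ j
    kc≤j = ≤-trans (*-monoˡ-≤ c (subst (λ q → suc k ≤ q + j / c) (m<n⇒m/n≡0 i<r) k≤)) (m/n*n≤m j c)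
  ... | no  i≮r = subst (All (_≤ j)) (sym dropped)
                    (drop-staircaseParts-≤ k (i ∸ r) j
                      (s≤s⁻¹ (subst (λ q → suc k ≤ q + j / c) (m/n≡1+[m∸n]/n r≤i) k≤)))
    where
    open ≡-Reasoning
    r≤i : r ≤ i
    r≤i = ≮⇒≥ i≮r
    top : List ℕ
    top = replicate r (suc k * c)
    dropped : drop i (top ++ staircaseParts r c k) ≡ drop (i ∸ r) (staircaseParts r c k)
    dropped = begin
      drop i (top ++ staircaseParts r c k)                ≡⟨ cong (λ m → drop m (top ++ staircaseParts r c k)) (m+[n∸m]≡n r≤i) ⟨
      drop (r + (i ∸ r)) (top ++ staircaseParts r c k)    ≡⟨ drop-drop r (i ∸ r) (top ++ staircaseParts r c k) ⟨
      drop (i ∸ r) (drop r (top ++ staircaseParts r c k)) ≡⟨ cong (drop (i ∸ r)) (drop-replicate-++ r (suc k * c) _) ⟩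
      drop (i ∸ r) (staircaseParts r c k)                 ∎

  -- Together with `staircase-nonEmpty`, this identifies the legal moves with the steps that satisfy
  -- the coordinate inequality.
  staircase-nonEmpty⁻¹ : ∀ k i j → NonEmpty (staircase r c k [ i , j ]) → i / r + j / c < k
  staircase-nonEmpty⁻¹ k i j ne = ≰⇒> λ k≤ → ne (filter-none (0 <?_) (All.map⁺
    (All.map (λ x≤j 0<x∸j → <⇒≢ 0<x∸j (sym (m≤n⇒m∸n≡0 x≤j))) (drop-staircaseParts-≤ k i j k≤))))

-- Grundy functions in coordinates

IsMex-unique : ∀ {P m n} → IsMex P m → IsMex P n → m ≡ n
IsMex-unique {_} {m} {n} (m∉ , <m) (n∉ , <n) with <-cmp m n
... | tri< m<n _ _ = contradiction (<n m<n) m∉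
... | tri≈ _ eq _  = eq
... | tri> _ _ n<m = contradiction (<m n<m) n∉

RookStep-positive : ∀ {a b} → RookStep a b → 1 ≤ a + b
RookStep-positive (rows    1≤m) = ≤-trans 1≤m (m≤m+n _ 0)
RookStep-positive (columns 1≤m) = 1≤m

module _ (r c k : ℕ) .{{_ : NonZero r}} .{{_ : NonZero c}} where

  Inside : ℕ → ℕ → Set
  Inside i j = i / r + j / c < k

  -- The two halves of the mex condition, carried over from partitions to coordinates.
  record IsGrundy (h : ℕ → ℕ → ℕ) : Set where
    field
      changes : ∀ {i j a b} → Inside i j → RookStep a b → Inside (i + a) (j + b) →
                h (i + a) (j + b) ≢ h i j
      attains : ∀ {i j n} → Inside i j → n < h i j →
                ∃ λ a → ∃ λ b → RookStep a b × Inside (i + a) (j + b) × h (i + a) (j + b) ≡ n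

  -- Each step raises `i + j`, while inside the staircase `i < k * r` and `j < k * c`. The fuel
  -- bounds the distance of `i + j` from `k * r + k * c`, so it cannot run out inside.
  IsGrundy⇒SG : ∀ {h} → IsGrundy h → ∀ i j → Inside i j → SG (staircase r c k [ i , j ]) ≡ h i j
  IsGrundy⇒SG {h} isG i j = go (k * r + k * c) i j (m≤n+m _ (i + j))
    where
    open IsGrundy isG
    Λ : Partition
    Λ = staircase r c k
    go : ∀ fuel i j → k * r + k * c ≤ i + j + fuel → Inside i j → SG (Λ [ i , j ]) ≡ h i j
    go zero i j le ins = contradiction
      (subst (k * r + k * c ≤_) (+-identityʳ (i + j)) le)
      (<⇒≱ (+-mono-< (/<⇒<* r (≤-<-trans (m≤m+n (i / r) (j / c)) ins))
                     (/<⇒<* c (≤-<-trans (m≤n+m (j / c) (i / r)) ins))))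
    go (suc fuel) i j le ins = IsMex-unique (SG-isMex (Λ [ i , j ])) (avoids , attained)
      where
      next : ∀ {a b} → RookStep a b → Inside (i + a) (j + b) →
             SG (Λ [ i , j ] [ a , b ]) ≡ h (i + a) (j + b)
      next {a} {b} st ins′ = trans (cong SG (shift-shift Λ i j a b)) (go fuel (i + a) (j + b) le′ ins′)
        where
        le′ : k * r + k * c ≤ i + a + (j + b) + fuel
        le′ = ≤-trans le (≤-trans (≤-reflexive (+-suc (i + j) fuel)) (+-monoˡ-≤ fuel
          (≤-trans (≤-reflexive (+-comm 1 (i + j)))
            (≤-trans (+-monoʳ-≤ (i + j) (RookStep-positive st)) (≤-reflexive (interchange i j a b))))))
          where
          interchange : ∀ i j a b → i + j + (a + b) ≡ i + a + (j + b)
          interchange = solve-∀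
      Reached : ℕ → Set
      Reached g = ∃ λ ν → Move (Λ [ i , j ]) ν × SG ν ≡ g
      avoids : Reached (h i j) → ⊥
      avoids (_ , (a , b , st , refl , ne) , eq) = changes ins st ins′ (trans (sym (next st ins′)) eq)
        where
        ins′ : Inside (i + a) (j + b)
        ins′ = staircase-nonEmpty⁻¹ r c k (i + a) (j + b) (subst NonEmpty (shift-shift Λ i j a b) ne)
      attained : ∀ {m} → m < h i j → Reached m
      attained m< with attains ins m<
      ... | a , b , st , ins′ , eq = Λ [ i , j ] [ a , b ] ,
        (a , b , st , refl , subst NonEmpty (sym (shift-shift Λ i j a b))
                               (staircase-nonEmpty r c k (i + a) (j + b) ins′)) ,
        trans (next st ins′) eq

-- The values on the staircase with r = c = 2^ℓ and K + 1 steps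

module _ (ℓ K : ℕ) where

  private
    D : ℕ
    D = 2 ^ ℓ
    instance
      D≢0 : NonZero D
      D≢0 = m^n≢0 2 ℓ

  InRange : ℕ → ℕ → Set
  InRange i j = i / D + j / D ≤ K

  level : ℕ → ℕ → ℕ
  level i j = K ∸ i / D ∸ j / D

  -- The residues of `i` and `j` replace those of their complements, as complementing both arguments
  -- preserves XOR.
  value : ℕ → ℕ → ℕ
  value i j = (i % D ⊕ⁿ j % D) + level i j * D

  InRange-comm : ∀ i j → InRange i j → InRange j i
  InRange-comm i j = subst (_≤ K) (+-comm (i / D) (j / D))

  InRange⇒/≤ : ∀ i j → InRange i j → j / D ≤ K ∸ i / D
  InRange⇒/≤ i j ran = m+n≤o⇒m≤o∸n (j / D) (InRange-comm i j ran)

  level-comm : ∀ i j → level i j ≡ level j i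
  level-comm i j = trans (∸-+-assoc K (i / D) (j / D))
    (trans (cong (K ∸_) (+-comm (i / D) (j / D))) (sym (∸-+-assoc K (j / D) (i / D))))

  value-comm : ∀ i j → value i j ≡ value j i
  value-comm i j = cong₂ (λ x f → x + f * D) (⊕ⁿ-comm (i % D) (j % D)) (level-comm i j)

  -- Because `D` is a power of two, the XOR of residues is the residue of a XOR.
  ⊕ⁿ-%-< : ∀ m n → m % D ⊕ⁿ n % D < D
  ⊕ⁿ-%-< m n = subst (_< D) (⊕-mod ℓ (+ m) (+ n)) (m%n<n (m ⊕ⁿ n) D)

  value-/ : ∀ i j → value i j / D ≡ level i j
  value-/ i j = [r+qd]/d≡q D (level i j) (⊕ⁿ-%-< i j)

  value-% : ∀ i j → value i j % D ≡ i % D ⊕ⁿ j % D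
  value-% i j = [r+qd]%d≡r D (level i j) (⊕ⁿ-%-< i j)

  -- The quotient of the value by `D` determines `j / D`, since in range no subtraction truncates;
  -- its remainder determines `j % D` by cancelling `i % D`.
  value-injectiveʳ : ∀ i {j j′} → InRange i j → InRange i j′ → value i j ≡ value i j′ → j ≡ j′
  value-injectiveʳ i {j} {j′} ran ran′ eq = /-%-injective D
    (∸-cancelˡ-≡ (InRange⇒/≤ i j ran) (InRange⇒/≤ i j′ ran′)
      (trans (sym (value-/ i j)) (trans (cong (_/ D) eq) (value-/ i j′))))
    (⊕ⁿ-injectiveʳ (i % D) (trans (sym (value-% i j)) (trans (cong (_% D) eq) (value-% i j′))))

  value-injectiveˡ : ∀ j {i i′} → InRange i j → InRange i′ j → value i j ≡ value i′ j → i ≡ i′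
  value-injectiveˡ j {i} {i′} ran ran′ eq = value-injectiveʳ j
    (InRange-comm i j ran) (InRange-comm i′ j ran′)
    (trans (value-comm j i) (trans eq (value-comm i′ j)))

  -- The column of a row with a prescribed value

  -- The solution `j` of `value i j ≡ n`, found by solving separately for its quotient and its
  -- remainder by `D`.
  column : ℕ → ℕ → ℕ
  column i n = (n % D ⊕ⁿ i % D) + (K ∸ i / D ∸ n / D) * D

  module _ {i n : ℕ} (le : i / D + n / D ≤ K) where

    column-/ : column i n / D ≡ K ∸ i / D ∸ n / D
    column-/ = [r+qd]/d≡q D (K ∸ i / D ∸ n / D) (⊕ⁿ-%-< n i)

    column-% : column i n % D ≡ n % D ⊕ⁿ i % D
    column-% = [r+qd]%d≡r D (K ∸ i / D ∸ n / D) (⊕ⁿ-%-< n i)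

    column-InRange : InRange i (column i n)
    column-InRange = begin
      i / D + column i n / D          ≡⟨ cong (λ q → i / D + q) column-/ ⟩
      i / D + (K ∸ i / D ∸ n / D)     ≤⟨ +-monoʳ-≤ (i / D) (m∸n≤m (K ∸ i / D) (n / D)) ⟩
      i / D + (K ∸ i / D)             ≡⟨ m+[n∸m]≡n (m+n≤o⇒m≤o (i / D) le) ⟩
      K                               ∎
      where open ≤-Reasoning

    level-column : level i (column i n) ≡ n / D
    level-column = trans (cong (λ v → K ∸ i / D ∸ v) column-/) (m∸[m∸n]≡n (InRange⇒/≤ i n le))

    value-column : value i (column i n) ≡ n
    value-column = trans
      (cong₂ (λ x f → x + f * D)
        (trans (cong (λ v → i % D ⊕ⁿ v) column-%) (⊕ⁿ-cancelˡ (i % D) (n % D))) level-column)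
      (sym (m≡m%n+[m/n]*n n D))

  -- A lower level means a larger quotient of the column, and at equal level the remainders decide;
  -- so `column i n` lies beyond `j`. With `i` and `j` exchanged it serves for row steps.
  advance : ∀ {i j n} → InRange i j →
            n / D < level i j ⊎ (n / D ≡ level i j × j % D < n % D ⊕ⁿ i % D) →
            ∃ λ m → 1 ≤ m × InRange i (j + m) × value i (j + m) ≡ n
  advance {i} {j} {n} ran later =
    column i n ∸ j , m<n⇒0<n∸m j<col ,
    subst (InRange i) (sym j+m≡col) (column-InRange {i} {n} le) ,
    trans (cong (value i) j+m≡col) (value-column {i} {n} le)
    where
    n/D≤ : n / D < level i j ⊎ (n / D ≡ level i j × j % D < n % D ⊕ⁿ i % D) → n / D ≤ level i j
    n/D≤ (inj₁ lt)       = <⇒≤ lt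
    n/D≤ (inj₂ (eq , _)) = ≤-reflexive eq
    le : i / D + n / D ≤ K
    le = ≤-trans (+-monoʳ-≤ (i / D) (≤-trans (n/D≤ later) (m∸n≤m (K ∸ i / D) (j / D))))
           (≤-reflexive (m+[n∸m]≡n (m+n≤o⇒m≤o (i / D) ran)))
    beyond : n / D < level i j ⊎ (n / D ≡ level i j × j % D < n % D ⊕ⁿ i % D) → j < column i n
    beyond (inj₁ lt) = /-reflects-< D
      (∸-cancelʳ-< {o = K ∸ i / D} (subst (_< level i j) (sym (level-column {i} {n} le)) lt))
    beyond (inj₂ (eq , lt)) = /-%-reflects-< D
      (∸-cancelˡ-≡ (InRange⇒/≤ i j ran) (InRange⇒/≤ i (column i n) (column-InRange {i} {n} le))
        (trans (sym eq) (sym (level-column {i} {n} le))))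
      (subst (j % D <_) (sym (column-% {i} {n} le)) lt)
    j<col : j < column i n
    j<col = beyond later
    j+m≡col : j + (column i n ∸ j) ≡ column i n
    j+m≡col = m+[n∸m]≡n (<⇒≤ j<col)

  -- The claimed values satisfy the mex condition

  value-IsGrundy : IsGrundy D D (suc K) value
  value-IsGrundy = record { changes = changes ; attains = attains }
    where
    m+n≢m : ∀ m {n} → 1 ≤ n → m + n ≢ m
    m+n≢m m 1≤n eq = <⇒≢ 1≤n (sym (+-cancelˡ-≡ m _ 0 (trans eq (sym (+-identityʳ m)))))

    changes : ∀ {i j a b} → Inside D D (suc K) i j → RookStep a b → Inside D D (suc K) (i + a) (j + b) →
              value (i + a) (j + b) ≢ value i j
    changes {i} {j} ins (rows {m} 1≤m) ins′ eq rewrite +-identityʳ j =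
      m+n≢m i 1≤m (value-injectiveˡ j (s≤s⁻¹ ins′) (s≤s⁻¹ ins) eq)
    changes {i} {j} ins (columns {m} 1≤m) ins′ eq rewrite +-identityʳ i =
      m+n≢m j 1≤m (value-injectiveʳ i (s≤s⁻¹ ins′) (s≤s⁻¹ ins) eq)

    Reach : ℕ → ℕ → ℕ → Set
    Reach i j n = ∃ λ a → ∃ λ b → RookStep a b × Inside D D (suc K) (i + a) (j + b) × value (i + a) (j + b) ≡ n

    along-columns : ∀ {i j n} → (∃ λ m → 1 ≤ m × InRange i (j + m) × value i (j + m) ≡ n) → Reach i j n
    along-columns {i} {j} {n} (m , 1≤m , ran , eq) = 0 , m , columns 1≤m ,
      -- `s≤s` turns the bound by `K` into the strict bound by `suc K`; only its domain is
      -- transported from `i + 0` to `i`.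
      subst (λ i′ → InRange i′ (j + m) → Inside D D (suc K) (i + 0) (j + m)) (+-identityʳ i) s≤s ran ,
      trans (cong (λ i′ → value i′ (j + m)) (+-identityʳ i)) eq

    along-rows : ∀ {i j n} → (∃ λ m → 1 ≤ m × InRange j (i + m) × value j (i + m) ≡ n) → Reach i j n
    along-rows {i} {j} {n} (m , 1≤m , ran , eq) = m , 0 , rows 1≤m ,
      subst (λ j′ → InRange (i + m) j′ → Inside D D (suc K) (i + m) (j + 0)) (+-identityʳ j) s≤s
        (InRange-comm j (i + m) ran) ,
      trans (cong (value (i + m)) (+-identityʳ j)) (trans (value-comm (i + m) j) eq)

    attains : ∀ {i j n} → Inside D D (suc K) i j → n < value i j → Reach i j n
    attains {i} {j} {n} (s≤s ran) n< with <⇒/<⊎%< D n<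
    ... | inj₁ lt = along-columns (advance {i} {j} {n} ran (inj₁ (subst (n / D <_) (value-/ i j) lt)))
    -- The level stays the same, and the XOR lemma decides whether the remainder of `i` or that of
    -- `j` is raised.
    ... | inj₂ (eq , lt) with ⊕ⁿ-increase (n % D) (i % D) (j % D) (subst (n % D <_) (value-% i j) lt)
    ...   | inj₁ l = along-rows (advance {j} {i} {n} (InRange-comm i j ran)
                       (inj₂ (trans eq (trans (value-/ i j) (level-comm i j)) , l)))
    ...   | inj₂ l = along-columns (advance {i} {j} {n} ran (inj₂ (trans eq (value-/ i j) , l)))

  SG≡value : ∀ i j → InRange i j → SG (staircase D D (suc K) [ i , j ]) ≡ value i j
  SG≡value i j ran = IsGrundy⇒SG D D (suc K) value-IsGrundy i j (s≤s ran)

  -i-1≡-[1+i] : ∀ i → ℤ.- (+ i) ℤ.- + 1 ≡ -[1+ i ]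
  -i-1≡-[1+i] zero    = refl
  -i-1≡-[1+i] (suc i) = cong (-[1+_] ∘ suc) (+-identityʳ i)

  -- The XOR of `-[1+ i ]` and `-[1+ j ]` computes to `+ (i ⊕ⁿ j)`, so `⊕-mod` is applied to the
  -- nonnegative `i` and `j`.
  value-formula : ∀ i j → value i j ≡ D * level i j + ((ℤ.- (+ i) ℤ.- + 1) ⊕ (ℤ.- (+ j) ℤ.- + 1)) %2^ ℓ
  value-formula i j rewrite -i-1≡-[1+i] i | -i-1≡-[1+i] j =
    trans (+-comm (i % D ⊕ⁿ j % D) (level i j * D))
      (cong₂ _+_ (*-comm (level i j) D) (sym (⊕-mod ℓ (+ i) (+ j))))

  -- (t + 1) * D ∸ 1 is a true predecessor, since D ≠ 0.
  /≤⇔≤∸1 : ∀ {n t} → (n / D ≤ t → n ≤ (t + 1) * D ∸ 1) × (n ≤ (t + 1) * D ∸ 1 → n / D ≤ t)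
  /≤⇔≤∸1 {n} {t} =
    (λ le → <⇒≤pred (/<⇒<* D (≤-<-trans le (m<m+n t z<s)))) ,
    (λ le → s≤s⁻¹ (subst (n / D <_) (+-comm t 1)
              (m<n*o⇒m/o<n (m≤pred[n]⇒suc[m]≤n {{nz}} le))))
    where
    nz : NonZero ((t + 1) * D)
    nz = m*n≢0 (t + 1) D {{subst NonZero (+-comm 1 t) _}}

  -- Sets of values along a row

  -- The set `S_t` for row `i`. The range condition matters at `t = 0`, since the truncated `level`
  -- is 0 outside the range too.
  RowValue : ℕ → ℕ → ℕ → Set
  RowValue i t n = ∃ λ j → InRange i j × level i j ≡ t × n ≡ SG (staircase D D (suc K) [ i , j ])

  RowValue⇒/ : ∀ {i t n} → RowValue i t n → n / D ≡ t
  RowValue⇒/ {i} (j , ran , lev , refl) =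
    trans (cong (_/ D) (SG≡value i j ran)) (trans (value-/ i j) lev)

  /⇒RowValue : ∀ {i n} → i / D + n / D ≤ K → RowValue i (n / D) n
  /⇒RowValue {i} {n} le = column i n , column-InRange {i} {n} le , level-column {i} {n} le ,
    sym (trans (SG≡value i (column i n) (column-InRange {i} {n} le)) (value-column {i} {n} le))

  -- The hypothesis on `i` says `i / D < suc K ∸ τ`, so row `i` is long enough to contain every
  -- level up to `τ`. The rewrite exposes a successor, which makes `∸ 1` a true predecessor.
  row-bound : ∀ {τ i} → τ ≤ K → i ≤ (suc K ∸ τ) * D ∸ 1 → i / D + τ ≤ K
  row-bound {τ} {i} τ≤K le rewrite +-∸-assoc 1 τ≤K =
    m≤o∸n⇒m+n≤o (i / D) τ≤K (s≤s⁻¹ (m<n*o⇒m/o<n (m≤pred[n]⇒suc[m]≤n {{m*n≢0 (suc (K ∸ τ)) D}} le)))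

  -- The interval consists of the `n` with `n / D ≡ τ`, and each such `n` is the value at
  -- `column i n`.
  rowValues : ∀ {τ i} → i / D + τ ≤ K →
              RowValue i τ ≐ λ n → τ * D ≤ n × n ≤ (τ + 1) * D ∸ 1
  rowValues {τ} {i} le = to , from
    where
    to : ∀ {n} → RowValue i τ n → τ * D ≤ n × n ≤ (τ + 1) * D ∸ 1
    to {n} v with RowValue⇒/ v
    ... | eq = subst (λ t → t * D ≤ n) eq (m/n*n≤m n D) , proj₁ /≤⇔≤∸1 (≤-reflexive eq)
    from : ∀ {n} → τ * D ≤ n × n ≤ (τ + 1) * D ∸ 1 → RowValue i τ n
    from {n} (lo , hi) = subst (λ t → RowValue i t n) eq
      (/⇒RowValue (subst (λ t → i / D + t ≤ K) (sym eq) le))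
      where
      eq : n / D ≡ τ
      eq = ≤-antisym (proj₂ /≤⇔≤∸1 hi) (subst (_≤ n / D) (m*n/n≡m τ D) (/-monoˡ-≤ D lo))

  rowValues-up-to : ∀ {τ i} → i / D + τ ≤ K →
                    (λ n → ∃ λ t → t ≤ τ × n ∈ RowValue i t) ≐ λ n → n ≤ (τ + 1) * D ∸ 1
  rowValues-up-to {τ} {i} le =
    (λ (t , t≤τ , v) → proj₁ /≤⇔≤∸1 (subst (_≤ τ) (sym (RowValue⇒/ v)) t≤τ)) ,
    λ {n} hi → let n/D≤τ = proj₂ /≤⇔≤∸1 hi in
      -- The level at which `n` occurs is its own quotient by `D`.
      n / D , n/D≤τ , /⇒RowValue (≤-trans (+-monoʳ-≤ (i / D) n/D≤τ) le)

proposition3p19 :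
  (ℓ k : ℕ) → 1 ≤ ℓ → 1 ≤ k →
  let Λ = staircase (2 ^ ℓ) (2 ^ ℓ) k {{m^n≢0 2 ℓ}}
      InRange = λ (i j : ℕ) → i /2^ ℓ + j /2^ ℓ ≤ k ∸ 1
      f = λ (i j : ℕ) → k ∸ 1 ∸ i /2^ ℓ ∸ j /2^ ℓ
      S = λ (i t n : ℕ) → ∃ λ j → InRange i j × f i j ≡ t × n ≡ SG (Λ [ i , j ])
  in
  (∀ i j → InRange i j →
     SG (Λ [ i , j ])
       ≡ 2 ^ ℓ * f i j + ((ℤ.- (+ i) ℤ.- + 1) ⊕ (ℤ.- (+ j) ℤ.- + 1)) %2^ ℓ)
  ×
  (∀ τ i → τ ≤ k ∸ 1 → i ≤ (k ∸ τ) * 2 ^ ℓ ∸ 1 →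
     (S i τ ≐ λ n → τ * 2 ^ ℓ ≤ n × n ≤ (τ + 1) * 2 ^ ℓ ∸ 1)
     ×
     ((λ n → ∃ λ t → t ≤ τ × n ∈ S i t) ≐ λ n → n ≤ (τ + 1) * 2 ^ ℓ ∸ 1))
-- As `k` is positive, it is `suc K`, and `k ∸ 1` computes to `K`.
proposition3p19 ℓ (suc K) _ _ =
  (λ i j ran → trans (SG≡value ℓ K i j ran) (value-formula ℓ K i j)) ,
  λ τ i τ≤K i≤ → let le = row-bound ℓ K {τ} {i} τ≤K i≤ in
    rowValues ℓ K {τ} {i} le , rowValues-up-to ℓ K {τ} {i} le
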